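{- Let $\mathcal{A}$ and $\mathcal{S}$ be Sudoku grids. If $\mathcal{S}$ is a logically deducible solution of $\mathcal{A}$ then it is the only solution of $\mathcal{A}$.
   Context: A Sudoku proposition is a formal symbol $r_ic_j \not\approx d$ with $i,j,d\in\{1,\dots,9\}$. Sudoku formulas are built inductively from Sudoku propositions and the constants $\top,\bot$ using $\lnot,\land,\lor,\Rightarrow,\Leftrightarrow$. A grid is a $9\times 9$ matrix $\mathcal{A}=[A_{ij}]_{9\times 9}$ of nonempty subsets $A_{ij}\subseteq\{1,\dots,9\}$; it is full if $|A_{ij}|=1$ for all $i,j$. Satisfaction $\mathcal{A}\models\phi$: $\mathcal{A}\models\top$ always, $\mathcal{A}\models\bot$ never, $\mathcal{A}\models r_ic_j\not\approx d$ iff $d\notin A_{ij}$, and the connectives are interpreted classically. Write $r_ic_j\equiv d$ for $\bigwedge_{s\ne d} r_ic_j\not\approx s$, and $r_ic_j\parallel r_\ell c_m$ for $\bigwedge_{1\le d\le 9}((r_ic_j\equiv d\Rightarrow r_\ell c_m\not\approx d)\land(r_\ell c_m\equiv d\Rightarrow r_ic_j\not\approx d))$. The set $\Sigma_{ax}$ consists of 27 formulas, one for each row, each column and each of the nine standard $3\times 3$ boxes: the conjunction of $r_ic_j\parallel r_\ell c_m$ over all pairs of distinct cells in that row, column or box. A Sudoku grid is a grid $\mathcal{A}$ with $\mathcal{A}\models\phi$ for all $\phi\in\Sigma_{ax}$ (i.e. whenever $A_{ij}=\{d\}$, $d$ belongs to no $A_{\ell m}$ for another cell in the same row, column or box). A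 full Sudoku grid is a Sudoku grid that is full. A solution of a Sudoku grid $\mathcal{A}=[A_{ij}]$ is a full Sudoku grid $\mathcal{S}=[S_{ij}]$ with $S_{ij}\subseteq A_{ij}$ for all $i,j$. A Sudoku axiom is a Sudoku formula that holds in every full Sudoku grid; $\Delta_{ax}$ is the set of all Sudoku axioms. For a set $\Phi$ of Sudoku formulas and a Sudoku formula $\alpha$, $\Phi\vdash\alpha$ means there is a finite sequence $\phi_1,\dots,\phi_n=\alpha$ of Sudoku formulas such that each $\phi_i$ is in $\Delta_{ax}$, or in $\Phi$, or is obtained by modus ponens from earlier formulas (there are $p,q<i$ with $\phi_q$ equal to $\phi_p\Rightarrow\phi_i$). $\Phi\vdash\Psi$ means $\Phi\vdash\alpha$ for all $\alpha\in\Psi$. For a Sudoku grid $\mathcal{A}$ let $\mathrm{Prop}(\mathcal{A})=\{r_ic_j\not\approx d: 1\le i,j,d\le 9,\ d\notin A_{ij}\}$. A solution $\mathcal{S}$ of $\mathcal{A}$ is a logically deducible solution of $\mathcal{A}$ if $\mathrm{Prop}(\mathcal{A})\vdash\mathrm{Prop}(\mathcal{S})$. -}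

module Defs where

open import Data.Empty using () renaming (⊥ to Empty)
open import Data.Fin.Base using (Fin; fromℕ; combine; quotient; remainder; _<_)
open import Data.Fin.Properties using (_≟_)
open import Data.Fin.Subset using (Subset; Nonempty; ∣_∣; _∈_; _∉_; _⊆_)
open import Data.Fin.Subset.Properties using (_∈?_)
open import Data.List.Base using (List; foldr; map; filter; allFin; concatMap)
open import Data.Nat.Base using (ℕ; suc)
open import Data.Product.Base using (_×_; _,_; ∃-syntax)
open import Data.Sum.Base using (_⊎_)
open import Data.Unit.Base using () renaming (⊤ to Unit)
open import Data.Vec.Functional using (Vector)
open import Level using (0ℓ)
open import Relation.Binary.PropositionalEquality using (_≡_)
open import Relation.Nullary using (Dec; yes; no; ¬_; ¬?; _×-dec_; _⊎-dec_; _→-dec_)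
open import Relation.Unary using (Pred)
import Relation.Unary as U

-- Rows, columns and digits 1, …, 9 are represented by the elements 0, …, 8
-- of Fin 9.

infix  9 r⟨_⟩c⟨_⟩≉_
infix  8 ~_
infixr 7 _∧_
infixr 6 _∨_
infixr 5 _⇒_
infix  4 _⇔_

data Formula : Set where
  r⟨_⟩c⟨_⟩≉_      : (i j d : Fin 9) → Formula
  ⊤ ⊥             : Formula
  ~_              : Formula → Formula
  _∧_ _∨_ _⇒_ _⇔_ : Formula → Formula → Formula

record Grid : Set where
  field
    cell     : Fin 9 → Fin 9 → Subset 9
    nonempty : ∀ i j → Nonempty (cell i j)

open Grid public

-- Equality of grids as matrices; the nonemptiness proofs are irrelevant.
infix 4 _≈_
_≈_ : Grid → Grid → Set
A ≈ B = ∀ i j → cell A i j ≡ cell B i j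

Full : Grid → Set
Full A = ∀ i j → ∣ cell A i j ∣ ≡ 1

infix 3 _⊨_ _⊨?_
_⊨_ : Grid → Formula → Set
A ⊨ r⟨ i ⟩c⟨ j ⟩≉ d = d ∉ cell A i j
A ⊨ ⊤               = Unit
A ⊨ ⊥               = Empty
A ⊨ ~ φ             = ¬ (A ⊨ φ)
A ⊨ φ ∧ ψ           = (A ⊨ φ) × (A ⊨ ψ)
A ⊨ φ ∨ ψ           = (A ⊨ φ) ⊎ (A ⊨ ψ)
A ⊨ φ ⇒ ψ           = (A ⊨ φ) → (A ⊨ ψ)
A ⊨ φ ⇔ ψ           = ((A ⊨ φ) → (A ⊨ ψ)) × ((A ⊨ ψ) → (A ⊨ φ))

-- Satisfaction is decidable, so the type-theoretic connectives above agree
-- with the classical truth tables.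
_⊨?_ : ∀ A φ → Dec (A ⊨ φ)
A ⊨? r⟨ i ⟩c⟨ j ⟩≉ d = ¬? (d ∈? cell A i j)
A ⊨? ⊤               = yes _
A ⊨? ⊥               = no λ ()
A ⊨? ~ φ             = ¬? (A ⊨? φ)
A ⊨? φ ∧ ψ           = (A ⊨? φ) ×-dec (A ⊨? ψ)
A ⊨? φ ∨ ψ           = (A ⊨? φ) ⊎-dec (A ⊨? ψ)
A ⊨? φ ⇒ ψ           = (A ⊨? φ) →-dec (A ⊨? ψ)
A ⊨? φ ⇔ ψ           = ((A ⊨? φ) →-dec (A ⊨? ψ)) ×-dec ((A ⊨? ψ) →-dec (A ⊨? φ))

⋀ : List Formula → Formula
⋀ = foldr _∧_ ⊤

Cell : Set
Cell = Fin 9 × Fin 9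

infix 8 _≐_ _∥_
_≐_ : Cell → Fin 9 → Formula
(i , j) ≐ d = ⋀ (map (λ s → r⟨ i ⟩c⟨ j ⟩≉ s) (filter (λ s → ¬? (s ≟ d)) (allFin 9)))

_∥_ : Cell → Cell → Formula
x@(i , j) ∥ y@(l , m) =
  ⋀ (map (λ d → (x ≐ d ⇒ r⟨ l ⟩c⟨ m ⟩≉ d) ∧ (y ≐ d ⇒ r⟨ i ⟩c⟨ j ⟩≉ d)) (allFin 9))

data House : Set where
  row column box : Fin 9 → House

-- Boxes, and the cells within a box, are numbered in reading order:
-- b = 3 · (band) + (stack), and likewise for the position k inside the box.
cells : House → Vector Cell 9
cells (row i)    k = i , k
cells (column j) k = k , j
cells (box b)    k = combine (quotient {3} 3 b) (quotient {3} 3 k)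
                   , combine (remainder {3} 3 b) (remainder {3} 3 k)

-- Every unordered pair of distinct cells occurs in both orders; ∥ is symmetric.
houseAxiom : House → Formula
houseAxiom h = ⋀ (concatMap
  (λ k → map (λ l → cells h k ∥ cells h l) (filter (λ l → ¬? (k ≟ l)) (allFin 9)))
  (allFin 9))

FormulaSet : Set₁
FormulaSet = Pred Formula 0ℓ

data Σax : FormulaSet where
  house : ∀ h → Σax (houseAxiom h)

IsSudoku : Grid → Set
IsSudoku A = ∀ φ → φ U.∈ Σax → A ⊨ φ

IsFullSudoku : Grid → Set
IsFullSudoku A = IsSudoku A × Full A

-- S is a solution of A.
IsSolution : Grid → Grid → Set
IsSolution S A = IsFullSudoku S × (∀ i j → cell S i j ⊆ cell A i j)

IsOnlySolution : Grid → Grid → Set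
IsOnlySolution S A = IsSolution S A × (∀ T → IsSolution T A → T ≈ S)

Δax : FormulaSet
Δax φ = ∀ A → IsFullSudoku A → A ⊨ φ

-- The proof is the nonempty sequence line 0, …, line n.
infix 3 _⊢_ _⊢⋆_
record _⊢_ (Φ : FormulaSet) (α : Formula) : Set where
  field
    n         : ℕ
    line      : Vector Formula (suc n)
    last      : line (fromℕ n) ≡ α
    justified : ∀ i → line i U.∈ Δax
                    ⊎ line i U.∈ Φ
                    ⊎ (∃[ p ] ∃[ q ] p < i × q < i × line q ≡ (line p ⇒ line i))

_⊢⋆_ : FormulaSet → FormulaSet → Set
Φ ⊢⋆ Ψ = ∀ α → α U.∈ Ψ → Φ ⊢ α

Props : Grid → FormulaSet
Props A φ = ∃[ i ] ∃[ j ] ∃[ d ] d ∉ cell A i j × φ ≡ r⟨ i ⟩c⟨ j ⟩≉ d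

IsLogicallyDeducibleSolution : Grid → Grid → Set
IsLogicallyDeducibleSolution S A = IsSolution S A × Props A ⊢⋆ Props S

{-# OPTIONS --safe #-}
-- Derivability is sound for full Sudoku grids. A solution T of A satisfies
-- Props A, hence Props S, i.e. T ⊆ S cellwise; as all cells of S and T are
-- singletons, T ≈ S.
module Submission where

open import Data.Fin.Base using (fromℕ; _<_)
open import Data.Fin.Induction using (<-wellFounded)
open import Data.Fin.Subset using (Subset; ∣_∣; _⊆_)
open import Data.Fin.Subset.Properties using (_∈?_; ⊆-antisym; p⊂q⇒∣p∣<∣q∣)
open import Data.Nat.Properties using (<⇒≢)
open import Data.Product.Base using (_,_)
open import Data.Sum.Base using (inj₁; inj₂)
open import Induction.WellFounded using (module All)
open import Level using (0ℓ)
open import Relation.Binary.PropositionalEquality using (_≡_; refl; sym; trans; subst)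
open import Relation.Nullary.Decidable using (decidable-stable)
import Relation.Unary as U

open import Defs

-- Propositions only exclude candidates, so they persist when cells shrink: any solution `T` of `A`
-- satisfies `Props A`. Being full, it also satisfies `Δax`, so every deduction from `Props A` holds
-- in it. Deducing `Props S` therefore confines each cell of `T` to that of `S`, and singletons
-- leave no choice.

⊢-sound : ∀ {Φ α} T → IsFullSudoku T → (∀ φ → φ U.∈ Φ → T ⊨ φ) → Φ ⊢ α → T ⊨ α
⊢-sound {Φ} T full T⊨Φ d = subst (T ⊨_) last (lines (fromℕ n))
  where
  open _⊢_ d

  step : ∀ i → (∀ {j} → j < i → T ⊨ line j) → T ⊨ line i
  step i rec with justified i
  ... | inj₁ axiom                              = axiom T full
  ... | inj₂ (inj₁ hypothesis)                  = T⊨Φ (line i) hypothesis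
  -- `⊨` reads `⇒` as a function space, so modus ponens is application.
  ... | inj₂ (inj₂ (p , q , p<i , q<i , line≡)) = subst (T ⊨_) line≡ (rec q<i) (rec p<i)

  lines : ∀ i → T ⊨ line i
  -- Modus ponens may cite any earlier lines, hence strong induction.
  lines = wfRec (λ i → T ⊨ line i) step
    where open All <-wellFounded 0ℓ

⊆⇒⊨Props : ∀ {A} T → (∀ i j → cell T i j ⊆ cell A i j) → ∀ φ → φ U.∈ Props A → T ⊨ φ
⊆⇒⊨Props T T⊆A _ (i , j , d , d∉A , refl) d∈T = d∉A (T⊆A i j d∈T)

-- By contraposition: a candidate absent from `A` is excluded by a member of `Props A`.
⊨Props⇒⊆ : ∀ {A} T → (∀ φ → φ U.∈ Props A → T ⊨ φ) → ∀ i j → cell T i j ⊆ cell A i j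
⊨Props⇒⊆ {A} T T⊨A i j {d} d∈T = decidable-stable (d ∈? cell A i j)
  λ d∉A → T⊨A (r⟨ i ⟩c⟨ j ⟩≉ d) (i , j , d , d∉A , refl) d∈T

-- An element of `q` outside `p` would make the inclusion strict, hence `p` smaller.
⊆∧∣∣≡⇒≡ : ∀ {n} {p q : Subset n} → p ⊆ q → ∣ p ∣ ≡ ∣ q ∣ → p ≡ q
⊆∧∣∣≡⇒≡ {p = p} p⊆q ∣p∣≡∣q∣ = ⊆-antisym p⊆q λ {x} x∈q →
  decidable-stable (x ∈? p) λ x∉p → <⇒≢ (p⊂q⇒∣p∣<∣q∣ (p⊆q , x , x∈q , x∉p)) ∣p∣≡∣q∣

theorem5p8 : (A S : Grid) → IsSudoku A → IsSudoku S →
    IsLogicallyDeducibleSolution S A → IsOnlySolution S A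
theorem5p8 A S _ _ (S-solves@((_ , S-full) , _) , deducible) = S-solves , only
  where
  only : ∀ T → IsSolution T A → T ≈ S
  only T (T-fullSudoku@(_ , T-full) , T⊆A) i j =
    ⊆∧∣∣≡⇒≡ (⊨Props⇒⊆ {S} T T⊨S i j) (trans (T-full i j) (sym (S-full i j)))
    where
    T⊨S : ∀ φ → φ U.∈ Props S → T ⊨ φ
    T⊨S φ φ∈S = ⊢-sound T T-fullSudoku (⊆⇒⊨Props {A} T T⊆A) (deducible φ φ∈S)
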